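{- Let $G$ be a $5/2$-closed transitive permutation group with a normal block system $\mathcal{B}$, and let $\mathcal{E}$ be the $\mathcal{B}$-fixer block system of $G$. Suppose that whenever $H\le G$ is a transitive subgroup and $\mathcal{C}$ is a normal block system of $H$ with $\mathcal{B}\preceq\mathcal{C}$, the block system $\mathcal{E}_{\mathcal{C}}$ induced by the $\mathcal{C}/\mathcal{B}$-fixer block system $\mathcal{E}_{\mathcal{C}}/\mathcal{B}$ of $H/\mathcal{B}$ satisfies $\mathcal{E}\preceq\mathcal{E}_{\mathcal{C}}$. Then $G/\mathcal{B}$ is $5/2$-closed.
   Context: All permutation groups act on finite sets. Let $G\le S_X$ be transitive. A block of $G$ is a subset $B\subseteq X$ such that $g(B)\cap B\in\{\emptyset,B\}$ for all $g\in G$; the set $\{g(B):g\in G\}$ for a (nonempty) block $B$ is a block system of $G$ (trivial cases, singletons and $\{X\}$, are allowed). A block system is normal if it is the set of orbits of some normal subgroup of $G$. For a block system $\mathcal{B}$, $\mathrm{fix}_G(\mathcal{B})=\{g\in G: g(B)=B \text{ for all } B\in\mathcal{B}\}$. If $K\le S_X$ leaves $Y\subseteq X$ invariant, $K^Y$ is the permutation group induced by $K$ on $Y$ (and $K^Y=1$ means $K$ fixes every point of $Y$). Quotients: $G/\mathcal{B}$ is the permutation group induced by $G$ on the set $\mathcal{B}$, and $g/\mathcal{B}$ is the permutation induced by $g\in G$; for a subgroup $H\le G$, $H/\mathcal{B}$ is the permutation group induced by $H$ on $\mathcal{B}$. Write $\mathcal{B}\preceq\mathcal{C}$ ("$\mathcal{B}$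 refines $\mathcal{C}$") if each block of $\mathcal{B}$ is contained in a block of $\mathcal{C}$. If $\mathcal{B}\preceq\mathcal{C}$, then $C/\mathcal{B}=\{B\in\mathcal{B}:B\subseteq C\}$ for $C\in\mathcal{C}$ and $\mathcal{C}/\mathcal{B}=\{C/\mathcal{B}:C\in\mathcal{C}\}$. Conversely, a block system of $G/\mathcal{B}$ (or of $H/\mathcal{B}$) is written $\mathcal{D}/\mathcal{B}$, where $\mathcal{D}$, the block system it induces, is the set of unions of the blocks of $\mathcal{B}$ contained in each of its blocks. Wreath stabilizer: for $\mathcal{B}$ a normal block system of $G$ and $B\in\mathcal{B}$, $\mathrm{WStab}_G(B)$ is the largest subgroup $K\le\mathrm{fix}_G(\mathcal{B})$ such that $K^B=1$ and, for every $B'\in\mathcal{B}$, $K^{B'}$ is trivial or transitive on $B'$ (it is the group generated by all subgroups with this property). Define $B\equiv B'$ on $\mathcal{B}$ iff $\mathrm{WStab}_G(B)=\mathrm{WStab}_G(B')$. The $\mathcal{B}$-fixer block system of $G$ is the set of subsets of $X$ that are unions of the blocks in an equivalence class of $\equiv$; it is a block system of $G$ refined by $\mathcal{B}$. For $g\in S_X$ and $Y\subseteq X$ with $g(Y)=Y$, $g|_Y\in S_X$ is the permutation equal to $g$ on $Y$ and to the identity off $Y$. A transitive group $G\le S_X$ is $5/2$-closed if for every transitive subgroup $H\le G$, every normal block system $\mathcal{B}_H$ of $H$, every block $E$ of the $\mathcal{B}_H$-fixer block system of $H$, and every $g\in G$ that fixes setwise each block of $\mathcal{B}_H$ contained in $E$,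 one has $g|_E\in G$. -}

module Defs where

open import Data.Bool.Base using (true; false; if_then_else_)
open import Data.Fin.Base using (Fin; zero; suc)
open import Data.Fin.Permutation
  using (Permutation′; permutation; _⟨$⟩ʳ_; _⟨$⟩ˡ_; inverseˡ; inverseʳ; _≈_; id; flip; _∘ₚ_; insert; remove; insert-remove)
open import Data.Fin.Properties using (any?; all?)
open import Data.Fin.Subset using (Subset; _∈_; _⊆_; _∩_; ⊥; Nonempty)
open import Data.Fin.Subset.Properties using (_∈?_; _⊆?_; ⊆-antisym)
open import Data.Nat.Base using (ℕ; zero; suc)
open import Data.Product.Base using (∃; ∃-syntax; _×_; _,_)
open import Data.Sum.Base using (_⊎_)
open import Data.Vec.Base using (lookup; tabulate)
open import Data.Vec.Properties
  using (lookup∘tabulate; tabulate∘lookup; tabulate-cong; []=⇒lookup; lookup⇒[]=; ≡-dec)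
open import Data.Bool.Properties using () renaming (_≟_ to _≟ᵇ_)
open import Function.Bundles using (_⇔_)
open import Function.Definitions using (Injective)
open import Level using (Level; 0ℓ; _⊔_) renaming (suc to lsuc)
open import Relation.Binary.PropositionalEquality
  using (_≡_; refl; sym; trans; cong; subst)
open import Relation.Nullary using (Dec; yes; no; does)
open import Relation.Nullary.Decidable using (_×-dec_; map′)
open import Relation.Unary using (Pred; Decidable; _≐_)

private
  variable
    n m k : ℕ
    ℓ ℓ₁ ℓ₂ : Level

-- The finite set X is Fin n, and subsets of X are Data.Fin.Subset.  A finite
-- set of subsets which is itself acted upon (a block system) is given by an
-- enumeration without repetition, Fin m → Subset n, so that the group induced
-- on it is again a permutation group on some Fin m.

------------------------------------------------------------------------
-- Permutation groups

-- Subgroups of the symmetric group on Fin n.  Permutations carry inverses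
-- and are compared pointwise, hence ∈-resp-≈.  Every subset of a finite
-- symmetric group is classically decidable; the field _∈ᴳ?_ records this.
record PermGroup (n : ℕ) : Set₁ where
  field
    Mem      : Pred (Permutation′ n) 0ℓ
    _∈ᴳ?_    : Decidable Mem
    ∈-resp-≈ : ∀ {g h} → g ≈ h → Mem g → Mem h
    id-∈     : Mem id
    ∘-∈      : ∀ {g h} → Mem g → Mem h → Mem (g ∘ₚ h)
    flip-∈   : ∀ {g} → Mem g → Mem (flip g)

open PermGroup

infix 4 _∈ᴳ_ _≤ᴳ_ _⊴_

_∈ᴳ_ : Permutation′ n → PermGroup n → Set
g ∈ᴳ G = Mem G g

_≤ᴳ_ : PermGroup n → PermGroup n → Set
H ≤ᴳ G = ∀ {g} → g ∈ᴳ H → g ∈ᴳ G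

_⊴_ : PermGroup n → PermGroup n → Set
N ⊴ G = N ≤ᴳ G × (∀ {g h} → g ∈ᴳ G → h ∈ᴳ N → (flip g ∘ₚ h ∘ₚ g) ∈ᴳ N)

Transitive : PermGroup n → Set
Transitive G = ∀ x y → ∃[ g ] g ∈ᴳ G × g ⟨$⟩ʳ x ≡ y

TrivialOn : PermGroup n → Subset n → Set
TrivialOn K Y = ∀ {g} → g ∈ᴳ K → ∀ {x} → x ∈ Y → g ⟨$⟩ʳ x ≡ x

TransitiveOn : PermGroup n → Subset n → Set
TransitiveOn K Y = ∀ {x y} → x ∈ Y → y ∈ Y → ∃[ g ] g ∈ᴳ K × g ⟨$⟩ʳ x ≡ y

data Generated {n} (P : Pred (Permutation′ n) ℓ) : Pred (Permutation′ n) ℓ where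
  gen  : ∀ {g} → P g → Generated P g
  one  : Generated P id
  mul  : ∀ {g h} → Generated P g → Generated P h → Generated P (g ∘ₚ h)
  inv  : ∀ {g} → Generated P g → Generated P (flip g)
  resp : ∀ {g h} → g ≈ h → Generated P g → Generated P h

------------------------------------------------------------------------
-- Images of subsets

infix 8 _⟨_⟩

_⟨_⟩ : Permutation′ n → Subset n → Subset n
g ⟨ B ⟩ = tabulate λ x → lookup B (g ⟨$⟩ˡ x)

flip-cong : {g h : Permutation′ n} → g ≈ h → flip g ≈ flip h
flip-cong {g = g} {h} g≈h x =
  trans (sym (inverseˡ h)) (cong (h ⟨$⟩ˡ_) (trans (sym (g≈h _)) (inverseʳ g)))

⟨⟩-cong : {g h : Permutation′ n} → g ≈ h → ∀ B → g ⟨ B ⟩ ≡ h ⟨ B ⟩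
⟨⟩-cong {g = g} {h} g≈h B = tabulate-cong λ x → cong (lookup B) (flip-cong {g = g} {h} g≈h x)

⟨⟩-id : (B : Subset n) → id ⟨ B ⟩ ≡ B
⟨⟩-id = tabulate∘lookup

⟨⟩-∘ : (g h : Permutation′ n) (B : Subset n) → (g ∘ₚ h) ⟨ B ⟩ ≡ h ⟨ g ⟨ B ⟩ ⟩
⟨⟩-∘ g h B = tabulate-cong λ x → sym (lookup∘tabulate _ (h ⟨$⟩ˡ x))

⟨⟩-flip : (g : Permutation′ n) (B : Subset n) → flip g ⟨ g ⟨ B ⟩ ⟩ ≡ B
⟨⟩-flip g B = trans (sym (⟨⟩-∘ g (flip g) B))
  (trans (⟨⟩-cong {g = g ∘ₚ flip g} {id} (λ _ → inverseˡ g) B) (⟨⟩-id B))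

∈-image⁺ : (g : Permutation′ n) (B : Subset n) {x : Fin n} → g ⟨$⟩ˡ x ∈ B → x ∈ g ⟨ B ⟩
∈-image⁺ g B {x} p = lookup⇒[]= x _ (trans (lookup∘tabulate _ x) ([]=⇒lookup p))

∈-image⁻ : (g : Permutation′ n) (B : Subset n) {x : Fin n} → x ∈ g ⟨ B ⟩ → g ⟨$⟩ˡ x ∈ B
∈-image⁻ g B {x} p = lookup⇒[]= _ B (trans (sym (lookup∘tabulate _ x)) ([]=⇒lookup p))

------------------------------------------------------------------------
-- Sets of subsets

⟦_⟧ : {P : Pred (Fin n) ℓ} → Decidable P → Subset n
⟦ P? ⟧ = tabulate λ x → does (P? x)

∈-⟦⟧⁺ : {P : Pred (Fin n) ℓ} (P? : Decidable P) {x : Fin n} → P x → x ∈ ⟦ P? ⟧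
∈-⟦⟧⁺ P? {x} px = lookup⇒[]= x _ (trans (lookup∘tabulate _ x) (does-true (P? x)))
  where
  does-true : (d : Dec _) → does d ≡ true
  does-true (yes _) = refl
  does-true (no ¬p) with () ← ¬p px

∈-⟦⟧⁻ : {P : Pred (Fin n) ℓ} (P? : Decidable P) {x : Fin n} → x ∈ ⟦ P? ⟧ → P x
∈-⟦⟧⁻ {P = P} P? {x} p = true-does (P? x) (trans (sym (lookup∘tabulate _ x)) ([]=⇒lookup p))
  where
  true-does : (d : Dec (P x)) → does d ≡ true → P x
  true-does (yes q) _ = q

infix 4 _Enumerates_ _⪯_

Members : (Fin m → Subset n) → Pred (Subset n) 0ℓ
Members ℬ B = ∃[ i ] ℬ i ≡ B

_Enumerates_ : (Fin m → Subset n) → Pred (Subset n) ℓ → Set ℓ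
ℬ Enumerates 𝒫 = Injective _≡_ _≡_ ℬ × Members ℬ ≐ 𝒫

_⪯_ : Pred (Subset n) ℓ₁ → Pred (Subset n) ℓ₂ → Set (ℓ₁ ⊔ ℓ₂)
𝒫 ⪯ 𝒬 = ∀ {P} → 𝒫 P → ∃[ Q ] 𝒬 Q × P ⊆ Q

covered? : (ℬ : Fin m → Subset n) (I : Subset m) →
           Decidable (λ x → ∃[ i ] i ∈ I × x ∈ ℬ i)
covered? ℬ I x = any? λ i → (i ∈? I) ×-dec (x ∈? ℬ i)

⋃[_] : (Fin m → Subset n) → Subset m → Subset n
⋃[ ℬ ] I = ⟦ covered? ℬ I ⟧

------------------------------------------------------------------------
-- Block systems

IsBlock : PermGroup n → Subset n → Set
IsBlock G B = ∀ {g} → g ∈ᴳ G → (g ⟨ B ⟩ ∩ B ≡ ⊥) ⊎ (g ⟨ B ⟩ ∩ B ≡ B)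

Translates : PermGroup n → Subset n → Pred (Subset n) 0ℓ
Translates G B B′ = ∃[ g ] g ∈ᴳ G × g ⟨ B ⟩ ≡ B′

Orbits : PermGroup n → Pred (Subset n) 0ℓ
Orbits N O = ∃[ x ] ∀ y → y ∈ O ⇔ (∃[ g ] g ∈ᴳ N × g ⟨$⟩ʳ x ≡ y)

IsBlockSystem : PermGroup n → (Fin m → Subset n) → Set
IsBlockSystem G ℬ = ∃[ B ] Nonempty B × IsBlock G B × ℬ Enumerates Translates G B

IsNormalBlockSystem : PermGroup n → (Fin m → Subset n) → Set₁
IsNormalBlockSystem G ℬ =
  IsBlockSystem G ℬ × ∃[ N ] (N ⊴ G × ℬ Enumerates Orbits N)

Fix : PermGroup n → (Fin m → Subset n) → Pred (Permutation′ n) 0ℓ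
Fix G ℬ g = g ∈ᴳ G × (∀ i → g ⟨ ℬ i ⟩ ≡ ℬ i)

------------------------------------------------------------------------
-- Wreath stabilizers and the fixer block system

record IsStabilizing (G : PermGroup n) (ℬ : Fin m → Subset n) (i : Fin m)
                     (K : PermGroup n) : Set where
  field
    ≤-fix                 : ∀ {g} → g ∈ᴳ K → Fix G ℬ g
    trivial-on-i          : TrivialOn K (ℬ i)
    trivial-or-transitive : ∀ j → TrivialOn K (ℬ j) ⊎ TransitiveOn K (ℬ j)

-- The property IsStabilizing passes to the subgroup generated by all subgroups
-- having it, so this is the largest such subgroup.
WStab : PermGroup n → (Fin m → Subset n) → Fin m → Pred (Permutation′ n) (lsuc 0ℓ)
WStab G ℬ i = Generated λ g → ∃[ K ] (IsStabilizing G ℬ i K × g ∈ᴳ K)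

IsFixerClass : PermGroup n → (Fin m → Subset n) → Subset m → Set₁
IsFixerClass G ℬ I = ∃[ i ] ∀ j → j ∈ I ⇔ (WStab G ℬ i ≐ WStab G ℬ j)

FixerSystem : PermGroup n → (Fin m → Subset n) → Pred (Subset n) (lsuc 0ℓ)
FixerSystem G ℬ E = ∃[ I ] (IsFixerClass G ℬ I × E ≡ ⋃[ ℬ ] I)

------------------------------------------------------------------------
-- Restriction of a permutation, and 5/2-closure

moveOn : Permutation′ n → Subset n → Fin n → Fin n
moveOn g E x = if lookup E x then g ⟨$⟩ʳ x else x

moveOn-cancel : (g : Permutation′ n) (E : Subset n) →
                (∀ x → lookup E (g ⟨$⟩ˡ x) ≡ lookup E x) →
                ∀ x → moveOn g E (moveOn (flip g) E x) ≡ x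
moveOn-cancel g E stable x with lookup E x in eq
... | true  rewrite trans (stable x) eq = inverseʳ g
... | false rewrite eq = refl

restrict : (g : Permutation′ n) (E : Subset n) → g ⟨ E ⟩ ≡ E → Permutation′ n
restrict g E gE≡E = permutation (moveOn g E) (moveOn (flip g) E)
  (moveOn-cancel g E stable) (moveOn-cancel (flip g) E stable′)
  where
  stable : ∀ x → lookup E (g ⟨$⟩ˡ x) ≡ lookup E x
  stable x = trans (sym (lookup∘tabulate _ x)) (cong (λ D → lookup D x) gE≡E)

  stable′ : ∀ x → lookup E (g ⟨$⟩ʳ x) ≡ lookup E x
  stable′ x = trans (sym (stable _)) (cong (lookup E) (inverseˡ g))

union-stable : (g : Permutation′ n) (ℬ : Fin m → Subset n) (I : Subset m) →
               (∀ i → ℬ i ⊆ ⋃[ ℬ ] I → g ⟨ ℬ i ⟩ ≡ ℬ i) →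
               g ⟨ ⋃[ ℬ ] I ⟩ ≡ ⋃[ ℬ ] I
union-stable g ℬ I fixes = ⊆-antisym ⊆₁ ⊆₂
  where
  E = ⋃[ ℬ ] I

  ℬ⊆E : ∀ {i} → i ∈ I → ℬ i ⊆ E
  ℬ⊆E {i} i∈I x∈ = ∈-⟦⟧⁺ (covered? ℬ I) (i , i∈I , x∈)

  ⊆₁ : g ⟨ E ⟩ ⊆ E
  ⊆₁ {x} x∈ with i , i∈I , p ← ∈-⟦⟧⁻ (covered? ℬ I) (∈-image⁻ g E x∈) =
    ℬ⊆E i∈I (subst (x ∈_) (fixes i (ℬ⊆E i∈I)) (∈-image⁺ g (ℬ i) p))

  ⊆₂ : E ⊆ g ⟨ E ⟩
  ⊆₂ {x} x∈ with i , i∈I , p ← ∈-⟦⟧⁻ (covered? ℬ I) x∈ =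
    ∈-image⁺ g E (ℬ⊆E i∈I (∈-image⁻ g (ℬ i) (subst (x ∈_) (sym (fixes i (ℬ⊆E i∈I))) p)))

fixer-stable : {G : PermGroup n} {ℬ : Fin m → Subset n} {E : Subset n} → FixerSystem G ℬ E →
               (g : Permutation′ n) → (∀ i → ℬ i ⊆ E → g ⟨ ℬ i ⟩ ≡ ℬ i) → g ⟨ E ⟩ ≡ E
fixer-stable {ℬ = ℬ} (I , _ , refl) g fixes = union-stable g ℬ I fixes

record FiveHalvesClosed (G : PermGroup n) : Set₁ where
  field
    transitive : Transitive G
    closed     : (H : PermGroup n) → H ≤ᴳ G → Transitive H →
                 ∀ {m} (ℬ : Fin m → Subset n) → IsNormalBlockSystem H ℬ →
                 ∀ {E} (E∈ : FixerSystem H ℬ E) →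
                 ∀ g → g ∈ᴳ G → (fixes : ∀ i → ℬ i ⊆ E → g ⟨ ℬ i ⟩ ≡ ℬ i) →
                 restrict g E (fixer-stable {G = H} E∈ g fixes) ∈ᴳ G

------------------------------------------------------------------------
-- Quotients

anyPerm? : {P : Pred (Permutation′ n) ℓ} → (∀ {g h} → g ≈ h → P g → P h) →
           Decidable P → Dec (∃ P)
anyPerm? {zero}  P-resp P? = map′ (id ,_) (λ (g , p) → P-resp (λ ()) p) (P? id)
anyPerm? {suc n} P-resp P? = map′
  (λ (j , g , p) → insert zero j g , p)
  (λ (g , p) → g ⟨$⟩ʳ zero , remove zero g , P-resp (λ x → sym (insert-remove zero g x)) p)
  (any? λ j → anyPerm? (λ {g} {h} g≈h → P-resp (insert-cong j g h g≈h)) (λ g → P? (insert zero j g)))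
  where
  insert-cong : ∀ j (g h : Permutation′ n) → g ≈ h → insert zero j g ≈ insert zero j h
  insert-cong j g h g≈h zero    = refl
  insert-cong j g h g≈h (suc x) rewrite g≈h x = refl

Induces : (Fin m → Subset n) → Permutation′ n → Permutation′ m → Set
Induces ℬ g σ = ∀ i → g ⟨ ℬ i ⟩ ≡ ℬ (σ ⟨$⟩ʳ i)

-- The group induced on the index set of ℬ; it is G/ℬ when G permutes the
-- members of ℬ and ℬ has no repetitions.
infixl 7 _/_ _/ᵇ_

_/_ : PermGroup n → (Fin m → Subset n) → PermGroup m
_/_ {n} {m} G ℬ = record
  { Mem      = λ σ → ∃[ g ] g ∈ᴳ G × Induces ℬ g σ
  ; _∈ᴳ?_    = λ σ → anyPerm?
      (λ {g} {h} g≈h (g∈G , p) →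
        ∈-resp-≈ G g≈h g∈G , λ i → trans (sym (⟨⟩-cong {g = g} {h} g≈h (ℬ i))) (p i))
      (λ g → (_∈ᴳ?_ G g) ×-dec all? λ i → ≡-dec _≟ᵇ_ (g ⟨ ℬ i ⟩) (ℬ (σ ⟨$⟩ʳ i)))
  ; ∈-resp-≈ = λ σ≈τ (g , g∈G , p) → g , g∈G , λ i → trans (p i) (cong ℬ (σ≈τ i))
  ; id-∈     = id , id-∈ G , λ i → ⟨⟩-id (ℬ i)
  ; ∘-∈      = λ { {σ} {τ} (g , g∈G , p) (h , h∈G , q) → g ∘ₚ h , ∘-∈ G g∈G h∈G ,
      λ i → trans (⟨⟩-∘ g h (ℬ i)) (trans (cong (h ⟨_⟩) (p i)) (q (σ ⟨$⟩ʳ i))) }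
  ; flip-∈   = λ { {σ} (g , g∈G , p) → flip g , flip-∈ G g∈G ,
      λ i → trans (cong (flip g ⟨_⟩) (trans (cong ℬ (sym (inverseʳ σ))) (sym (p (σ ⟨$⟩ˡ i)))))
                  (⟨⟩-flip g (ℬ (σ ⟨$⟩ˡ i))) }
  }

_/ᵇ_ : (Fin k → Subset n) → (Fin m → Subset n) → (Fin k → Subset m)
(𝒞 /ᵇ ℬ) c = ⟦ (λ i → ℬ i ⊆? 𝒞 c) ⟧

Induced : (Fin m → Subset n) → Pred (Subset m) ℓ → Pred (Subset n) ℓ
Induced ℬ 𝒟 D = ∃[ I ] (𝒟 I × D ≡ ⋃[ ℬ ] I)

module Submission where

-- Let H′ ≤ G/ℬ be transitive with a normal block system 𝒟.  Let H be the
-- preimage of H′ in G and 𝒞 the block system induced by 𝒟.  Since ℬ is normal,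
-- the fixer of ℬ in G is transitive on each block of ℬ.  Hence H is transitive,
-- 𝒞 is a normal block system of H, H/ℬ = H′ and 𝒞/ℬ = 𝒟.
--
-- The key point (≈ʷ-descends) is that blocks of 𝒞 with the same wreath
-- stabilizer in H come from blocks of 𝒟 with the same wreath stabilizer in H′.
-- Let K ≤ H′ fix every block of 𝒟, be trivial on a block D of 𝒟 and be trivial
-- or transitive on each of the others, as in the definition of the wreath
-- stabilizer of D.  The preimage of K fixes each block of ℬ inside D, but need not fix its points.  This is
-- repaired as follows.  The blocks of 𝒟 on which K is trivial form a union of
-- equivalence classes, so by the hypothesis the blocks of ℬ inside them form a
-- union T of ℬ-fixer blocks of G.  Applying 5/2-closure to G, ℬ and these fixer
-- blocks, one after the other, the action on T of any element of the preimage
-- of K can be divided out without leaving G (suppress).  Therefore the group L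
-- of those elements of G which induce an element of K and fix T pointwise still
-- maps onto K.  It is trivial on the blocks of 𝒞 inside T and transitive on the
-- others, the fixer of ℬ being transitive on the blocks of ℬ outside T even
-- after its action on T is divided out.  So L lies in the wreath stabilizer in
-- H of the block of 𝒞 over D.  If another block of 𝒞 has the same wreath
-- stabilizer, L is trivial on it, hence so is K on the block of 𝒟 below it.
--
-- Consequently the union of the blocks of ℬ in a 𝒟-fixer block E of H′ is a
-- union of 𝒞-fixer blocks of H.  If σ in G/ℬ fixes each block of 𝒟 in E, then a
-- second use of suppress, for H and 𝒞, shows that the restriction of a lift of σ
-- to this union lies in G; it induces the restriction of σ to E
-- (restrict-lifts).
--
-- No decision procedure for the equality of wreath stabilizers is constructed:
-- the equivalence classes are shown to exist as finite subsets only up to double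
-- negation.  This suffices because membership in G/ℬ is decidable.

open import Defs
open import Data.Bool.Base using (true; false)
open import Data.Bool.Properties using () renaming (_≟_ to _≟ᵇ_)
open import Data.Fin.Base using (Fin)
open import Data.Fin.Permutation
  using (Permutation′; _⟨$⟩ʳ_; _⟨$⟩ˡ_; inverseˡ; inverseʳ; _≈_; id; flip; _∘ₚ_; permutation)
open import Data.Fin.Properties using (all?; any?; sequence) renaming (_≟_ to _≟ᶠ_)
open import Data.Fin.Subset using (Subset; _∈_; _∉_; _⊆_; _∩_; ⊥; Nonempty)
open import Data.Fin.Subset.Properties
  using (_∈?_; _⊆?_; ⊆-antisym; x∈p∩q⁺; x∈p∩q⁻; ∉⊥)
open import Data.List.Base using (List; []; _∷_; allFin)
open import Data.List.Membership.Propositional using () renaming (_∈_ to _∈ˡ_)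
open import Data.List.Membership.Propositional.Properties using (∈-allFin)
open import Data.List.Relation.Unary.Any using (here; there)
open import Data.Product.Base using (∃-syntax; _×_; _,_; proj₁; proj₂)
open import Data.Sum.Base using (_⊎_; inj₁; inj₂)
import Data.Sum.Base as Sum
open import Data.Vec.Base using (lookup)
open import Data.Vec.Properties using (≡-dec; []=⇒lookup; lookup⇒[]=)
open import Effect.Monad using (RawMonad)
open import Function.Bundles using (_⇔_; mk⇔; Equivalence)
open import Relation.Binary.PropositionalEquality
  using (_≡_; refl; sym; trans; cong; subst)
open import Relation.Nullary using (¬_; Dec; yes; no)
open import Relation.Nullary.Decidable
  using (_×-dec_; _→-dec_; ¬?; map′; decidable-stable; ¬¬-excluded-middle)
open import Relation.Nullary.Negation using (contradiction; ¬¬-map; ¬¬-Monad)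
open import Relation.Unary using (Pred; _≐_)
open import Relation.Unary.Properties using (≐-refl; ≐-trans)

open PermGroup
open Equivalence using (to; from)

------------------------------------------------------------------------
-- Images and unions of subsets

-- The permutations g and h take the same values on B.
AgreeOn : ∀ {n} → Permutation′ n → Permutation′ n → Subset n → Set
AgreeOn g h B = ∀ {x} → x ∈ B → g ⟨$⟩ʳ x ≡ h ⟨$⟩ʳ x

module _ {n} (g : Permutation′ n) where

  ∈⇒image : ∀ B {x} → x ∈ B → g ⟨$⟩ʳ x ∈ g ⟨ B ⟩
  ∈⇒image B x∈ = ∈-image⁺ g B (subst (_∈ B) (sym (inverseˡ g)) x∈)

  image-⊆ : ∀ {B C} → (∀ {x} → x ∈ B → g ⟨$⟩ʳ x ∈ C) → g ⟨ B ⟩ ⊆ C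
  image-⊆ {B} {C} f x∈ = subst (_∈ C) (inverseʳ g) (f (∈-image⁻ g B x∈))

image-cong : ∀ {n} (g h : Permutation′ n) {B} → AgreeOn g h B → g ⟨ B ⟩ ≡ h ⟨ B ⟩
image-cong g h {B} eq = ⊆-antisym
  (image-⊆ g λ {x} x∈ → subst (_∈ h ⟨ B ⟩) (sym (eq x∈)) (∈⇒image h B x∈))
  (image-⊆ h λ {x} x∈ → subst (_∈ g ⟨ B ⟩) (eq x∈) (∈⇒image g B x∈))

∈⋃⁺ : ∀ {n m} (ℬ : Fin m → Subset n) {I i x} → i ∈ I → x ∈ ℬ i → x ∈ ⋃[ ℬ ] I
∈⋃⁺ ℬ {I} {i} i∈ x∈ = ∈-⟦⟧⁺ (covered? ℬ I) (i , i∈ , x∈)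

∈⋃⁻ : ∀ {n m} (ℬ : Fin m → Subset n) {I x} → x ∈ ⋃[ ℬ ] I → ∃[ i ] i ∈ I × x ∈ ℬ i
∈⋃⁻ ℬ {I} = ∈-⟦⟧⁻ (covered? ℬ I)

------------------------------------------------------------------------
-- Induced permutations

-- The permutations are explicit arguments: they occur in Induces only through
-- their values, from which they cannot be inferred.
module _ {n m} (ℬ : Fin m → Subset n) where

  Induces-∈ : ∀ g σ → Induces ℬ g σ → ∀ {i x} → x ∈ ℬ i → g ⟨$⟩ʳ x ∈ ℬ (σ ⟨$⟩ʳ i)
  Induces-∈ g σ ind {i} x∈ = subst (_ ∈_) (ind i) (∈⇒image g (ℬ i) x∈)

  Induces-id : Induces ℬ id id
  Induces-id i = ⟨⟩-id (ℬ i)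

  Induces-∘ : ∀ g h σ τ → Induces ℬ g σ → Induces ℬ h τ → Induces ℬ (g ∘ₚ h) (σ ∘ₚ τ)
  Induces-∘ g h σ τ p q i =
    trans (⟨⟩-∘ g h (ℬ i)) (trans (cong (h ⟨_⟩) (p i)) (q (σ ⟨$⟩ʳ i)))

  Induces-flip : ∀ g σ → Induces ℬ g σ → Induces ℬ (flip g) (flip σ)
  Induces-flip g σ p i =
    trans (cong (flip g ⟨_⟩) (trans (cong ℬ (sym (inverseʳ σ))) (sym (p (σ ⟨$⟩ˡ i)))))
          (⟨⟩-flip g (ℬ (σ ⟨$⟩ˡ i)))

  Induces-respˡ : ∀ {g h} σ → g ≈ h → Induces ℬ g σ → Induces ℬ h σ
  Induces-respˡ {g} {h} σ g≈h p i = trans (sym (⟨⟩-cong {g = g} {h} g≈h (ℬ i))) (p i)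

  Induces-respʳ : ∀ g {σ τ} → σ ≈ τ → Induces ℬ g σ → Induces ℬ g τ
  Induces-respʳ g σ≈τ p i = trans (p i) (cong ℬ (σ≈τ i))

  Induces? : ∀ g σ → Dec (Induces ℬ g σ)
  Induces? g σ = all? λ i → ≡-dec _≟ᵇ_ (g ⟨ ℬ i ⟩) (ℬ (σ ⟨$⟩ʳ i))

  image-⋃ : ∀ g σ → Induces ℬ g σ → ∀ I → g ⟨ ⋃[ ℬ ] I ⟩ ≡ ⋃[ ℬ ] (σ ⟨ I ⟩)
  image-⋃ g σ ind I = ⊆-antisym
    (image-⊆ g λ x∈ → let i , i∈ , x∈i = ∈⋃⁻ ℬ x∈ in
      ∈⋃⁺ ℬ (∈⇒image σ I i∈) (Induces-∈ g σ ind x∈i))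
    (λ x∈ → let i , i∈ , x∈i = ∈⋃⁻ ℬ x∈ in
      ∈-image⁺ g (⋃[ ℬ ] I)
        (∈⋃⁺ ℬ (∈-image⁻ σ I i∈) (Induces-∈ (flip g) (flip σ) (Induces-flip g σ ind) x∈i)))

-- The preimage in G of a group K of permutations of the index set of ℬ: the
-- elements of G which induce on ℬ an element of K.
lift : ∀ {n m} → PermGroup n → (Fin m → Subset n) → PermGroup m → PermGroup n
lift G ℬ K = record
  { Mem      = λ g → g ∈ᴳ G × ∃[ σ ] σ ∈ᴳ K × Induces ℬ g σ
  ; _∈ᴳ?_    = λ g → (_∈ᴳ?_ G g) ×-dec anyPerm?
      (λ {σ} {τ} σ≈τ (σ∈ , p) →
        ∈-resp-≈ K {σ} {τ} σ≈τ σ∈ , Induces-respʳ ℬ g {σ} {τ} σ≈τ p)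
      (λ σ → (_∈ᴳ?_ K σ) ×-dec Induces? ℬ g σ)
  ; ∈-resp-≈ = λ { {g} {h} g≈h (g∈ , σ , σ∈ , p) →
      ∈-resp-≈ G {g} {h} g≈h g∈ , σ , σ∈ , Induces-respˡ ℬ {g} {h} σ g≈h p }
  ; id-∈     = id-∈ G , id , id-∈ K , Induces-id ℬ
  ; ∘-∈      = λ { {g} {h} (g∈ , σ , σ∈ , p) (h∈ , τ , τ∈ , q) →
      ∘-∈ G g∈ h∈ , σ ∘ₚ τ , ∘-∈ K σ∈ τ∈ , Induces-∘ ℬ g h σ τ p q }
  ; flip-∈   = λ { {g} (g∈ , σ , σ∈ , p) →
      flip-∈ G g∈ , flip σ , flip-∈ K σ∈ , Induces-flip ℬ g σ p }
  }

-- The pointwise stabilizer of Y in K.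
fixing : ∀ {n} → PermGroup n → Subset n → PermGroup n
fixing K Y = record
  { Mem      = λ g → g ∈ᴳ K × (∀ x → x ∈ Y → g ⟨$⟩ʳ x ≡ x)
  ; _∈ᴳ?_    = λ g → (_∈ᴳ?_ K g) ×-dec all? λ x → (x ∈? Y) →-dec (g ⟨$⟩ʳ x ≟ᶠ x)
  ; ∈-resp-≈ = λ { {g} {h} g≈h (g∈ , p) →
      ∈-resp-≈ K {g} {h} g≈h g∈ , λ x x∈ → trans (sym (g≈h x)) (p x x∈) }
  ; id-∈     = id-∈ K , λ _ _ → refl
  ; ∘-∈      = λ { {g} {h} (g∈ , p) (h∈ , q) →
      ∘-∈ K g∈ h∈ , λ x x∈ → trans (cong (h ⟨$⟩ʳ_) (p x x∈)) (q x x∈) }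
  ; flip-∈   = λ { {g} (g∈ , p) →
      flip-∈ K g∈ , λ x x∈ → trans (cong (g ⟨$⟩ˡ_) (sym (p x x∈))) (inverseˡ g) }
  }

trivialOn? : ∀ {n} (K : PermGroup n) (Y : Subset n) → Dec (TrivialOn K Y)
trivialOn? K Y = map′
  (λ none {g} g∈ {x} x∈ → decidable-stable (g ⟨$⟩ʳ x ≟ᶠ x) λ gx≢x →
    none (g , g∈ , x , x∈ , gx≢x))
  (λ triv (g , g∈ , x , x∈ , gx≢x) → gx≢x (triv g∈ x∈))
  (¬? (anyPerm?
    (λ {g} {h} g≈h (g∈ , x , x∈ , gx≢x) →
      ∈-resp-≈ K {g} {h} g≈h g∈ , x , x∈ , λ hx≡x → gx≢x (trans (g≈h x) hx≡x))
    (λ g → (_∈ᴳ?_ K g) ×-dec any? λ x → (x ∈? Y) ×-dec ¬? (g ⟨$⟩ʳ x ≟ᶠ x))))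

------------------------------------------------------------------------
-- Normal block systems of transitive groups

module NormalBlockSystem {n m} (H : PermGroup n) (H-trans : Transitive H)
                         (ℬ : Fin m → Subset n) (nbs : IsNormalBlockSystem H ℬ) where

  private
    base = proj₁ (proj₁ nbs)
    translates = proj₂ (proj₂ (proj₂ (proj₁ nbs)))
    orbits = proj₂ (proj₂ (proj₂ nbs))

  -- A normal subgroup whose orbits are the blocks.
  N = proj₁ (proj₂ nbs)

  N⊴H : N ⊴ H
  N⊴H = proj₁ (proj₂ (proj₂ nbs))

  injective : ∀ {i j} → ℬ i ≡ ℬ j → i ≡ j
  injective = proj₁ translates

  -- The translates of a nonempty set under a transitive group cover.
  covers : ∀ x → ∃[ i ] x ∈ ℬ i
  covers x =
    let b , b∈ = proj₁ (proj₂ (proj₁ nbs))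
        g , g∈ , gb≡x = H-trans b x
        i , ℬi≡ = proj₂ (proj₂ translates) (g , g∈ , refl)
    in i , subst (x ∈_) (sym ℬi≡) (subst (_∈ g ⟨ base ⟩) gb≡x (∈⇒image g base b∈))

  -- A block is the N-orbit of each of its points, not only of the chosen one.
  orbit : ∀ {i x} → x ∈ ℬ i → ∀ y → y ∈ ℬ i ⇔ (∃[ g ] g ∈ᴳ N × g ⟨$⟩ʳ x ≡ y)
  orbit {i} {x} x∈ y with z , orb ← proj₁ (proj₂ orbits) (i , refl)
                     with g , g∈ , refl ← to (orb x) x∈ = mk⇔
    (λ y∈ → let h , h∈ , hz≡y = to (orb y) y∈ in
      flip g ∘ₚ h , ∘-∈ N (flip-∈ N g∈) h∈ , trans (cong (h ⟨$⟩ʳ_) (inverseˡ g)) hz≡y)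
    (λ (h , h∈ , hx≡y) → from (orb y) (g ∘ₚ h , ∘-∈ N g∈ h∈ , hx≡y))

  nonempty : ∀ i → Nonempty (ℬ i)
  nonempty i with z , orb ← proj₁ (proj₂ orbits) (i , refl) =
    z , from (orb z) (id , id-∈ N , refl)

  disjoint : ∀ {i j x} → x ∈ ℬ i → x ∈ ℬ j → i ≡ j
  disjoint x∈i x∈j = injective (⊆-antisym
    (λ {y} y∈ → from (orbit x∈j y) (to (orbit x∈i y) y∈))
    (λ {y} y∈ → from (orbit x∈i y) (to (orbit x∈j y) y∈)))

  N-fixes-blocks : ∀ {g} → g ∈ᴳ N → ∀ i → g ⟨ ℬ i ⟩ ≡ ℬ i
  N-fixes-blocks {g} g∈ i = ⊆-antisym
    (image-⊆ g λ x∈ → from (orbit x∈ _) (g , g∈ , refl))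
    (λ {x} x∈ → ∈-image⁺ g (ℬ i) (from (orbit x∈ _) (flip g , flip-∈ N g∈ , refl)))

  -- The fixer of the block system is transitive on each block.
  Fix-transitive : ∀ {i x y} → x ∈ ℬ i → y ∈ ℬ i → ∃[ g ] Fix H ℬ g × g ⟨$⟩ʳ x ≡ y
  Fix-transitive {y = y} x∈ y∈ =
    let g , g∈ , gx≡y = to (orbit x∈ y) y∈
    in g , (proj₁ N⊴H g∈ , N-fixes-blocks g∈) , gx≡y

  -- Since the blocks are nonempty and disjoint, a union of blocks determines
  -- its set of indices.
  ⊆⋃⇒∈ : ∀ {I i} → ℬ i ⊆ ⋃[ ℬ ] I → i ∈ I
  ⊆⋃⇒∈ {I} {i} ⊆⋃ =
    let x , x∈ = nonempty i
        j , j∈ , x∈j = ∈⋃⁻ ℬ (⊆⋃ x∈)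
    in subst (_∈ I) (disjoint x∈j x∈) j∈

  ⋃-∈ : ∀ {I i x} → x ∈ ℬ i → x ∈ ⋃[ ℬ ] I → i ∈ I
  ⋃-∈ {I} x∈ x∈⋃ =
    let j , j∈ , x∈j = ∈⋃⁻ ℬ x∈⋃ in subst (_∈ I) (disjoint x∈j x∈) j∈

  ⋃-injective : ∀ {I J} → ⋃[ ℬ ] I ≡ ⋃[ ℬ ] J → I ≡ J
  ⋃-injective eq = ⊆-antisym
    (λ i∈ → ⊆⋃⇒∈ λ x∈ → subst (_ ∈_) eq (∈⋃⁺ ℬ i∈ x∈))
    (λ i∈ → ⊆⋃⇒∈ λ x∈ → subst (_ ∈_) (sym eq) (∈⋃⁺ ℬ i∈ x∈))

  ⋃-∩ : ∀ I J → ⋃[ ℬ ] I ∩ ⋃[ ℬ ] J ≡ ⋃[ ℬ ] (I ∩ J)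
  ⋃-∩ I J = ⊆-antisym
    (λ x∈ → let x∈I , x∈J = x∈p∩q⁻ _ _ x∈
                i , i∈ , x∈i = ∈⋃⁻ ℬ x∈I
            in ∈⋃⁺ ℬ (x∈p∩q⁺ (i∈ , ⋃-∈ x∈i x∈J)) x∈i)
    (λ x∈ → let i , i∈ , x∈i = ∈⋃⁻ ℬ x∈
                i∈I , i∈J = x∈p∩q⁻ I J i∈
            in x∈p∩q⁺ (∈⋃⁺ ℬ i∈I x∈i , ∈⋃⁺ ℬ i∈J x∈i))

  ⋃-⊥ : ⋃[ ℬ ] ⊥ ≡ ⊥
  ⋃-⊥ = ⊆-antisym (λ x∈ → let _ , i∈ , _ = ∈⋃⁻ ℬ x∈ in contradiction i∈ ∉⊥)
                  (λ x∈ → contradiction x∈ ∉⊥)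

  Induces-fixed : ∀ g σ → Induces ℬ g σ → ∀ {i x} → x ∈ ℬ i → g ⟨$⟩ʳ x ≡ x →
                  σ ⟨$⟩ʳ i ≡ i
  Induces-fixed g σ ind {i} x∈ gx≡x =
    disjoint (Induces-∈ ℬ g σ ind x∈) (subst (_∈ ℬ i) (sym gx≡x) x∈)

  Induces-unique : ∀ g σ τ → Induces ℬ g σ → Induces ℬ g τ → σ ≈ τ
  Induces-unique g σ τ p q i = injective (trans (sym (p i)) (q i))

  -- Every element of H permutes the blocks.
  induced : ∀ {g} → g ∈ᴳ H → ∃[ σ ] Induces ℬ g σ
  induced {g} g∈ = permutation (f g∈) (f (flip-∈ H g∈)) inv₁ inv₂ , eq g∈
    where
    image : ∀ {h} → h ∈ᴳ H → ∀ i → ∃[ j ] ℬ j ≡ h ⟨ ℬ i ⟩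
    image {h} h∈ i =
      let k , k∈ , k≡ = proj₁ (proj₂ translates) (i , refl)
      in proj₂ (proj₂ translates)
           (k ∘ₚ h , ∘-∈ H k∈ h∈ , trans (⟨⟩-∘ k h base) (cong (h ⟨_⟩) k≡))

    f : ∀ {h} → h ∈ᴳ H → Fin m → Fin m
    f h∈ i = proj₁ (image h∈ i)

    eq : ∀ {h} (h∈ : h ∈ᴳ H) i → h ⟨ ℬ i ⟩ ≡ ℬ (f h∈ i)
    eq h∈ i = sym (proj₂ (image h∈ i))

    inv₁ : ∀ i → f g∈ (f (flip-∈ H g∈) i) ≡ i
    inv₁ i = injective (trans (sym (eq g∈ _))
      (trans (cong (g ⟨_⟩) (sym (eq (flip-∈ H g∈) i))) (⟨⟩-flip (flip g) (ℬ i))))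

    inv₂ : ∀ i → f (flip-∈ H g∈) (f g∈ i) ≡ i
    inv₂ i = injective (trans (sym (eq (flip-∈ H g∈) _))
      (trans (cong (flip g ⟨_⟩) (sym (eq g∈ i))) (⟨⟩-flip g (ℬ i))))

  quotient-transitive : Transitive (H / ℬ)
  quotient-transitive i j =
    let x , x∈ = nonempty i
        y , y∈ = nonempty j
        g , g∈ , gx≡y = H-trans x y
        σ , ind = induced g∈
    in σ , (g , g∈ , ind) , disjoint (Induces-∈ ℬ g σ ind x∈) (subst (_∈ ℬ j) (sym gx≡y) y∈)

  Induces-fix : ∀ g f σ → Induces ℬ g σ → (∀ i → f ⟨ ℬ i ⟩ ≡ ℬ i) → Induces ℬ (g ∘ₚ f) σ
  Induces-fix g f σ p q = Induces-∘ ℬ g f σ id p q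

  -- An element of H inducing σ can be adjusted by the fixer of the block
  -- system so as to carry any point of a block ℬ i to any point of ℬ (σ i).
  lift-point : ∀ σ → σ ∈ᴳ (H / ℬ) → ∀ {i x y} → x ∈ ℬ i → y ∈ ℬ (σ ⟨$⟩ʳ i) →
               ∃[ g ] g ∈ᴳ H × Induces ℬ g σ × g ⟨$⟩ʳ x ≡ y
  lift-point σ (g , g∈ , ind) x∈ y∈ =
    let f , (f∈ , fix) , eq = Fix-transitive (Induces-∈ ℬ g σ ind x∈) y∈
    in g ∘ₚ f , ∘-∈ H g∈ f∈ , Induces-fix g f σ ind fix , eq

------------------------------------------------------------------------
-- Wreath stabilizers

-- Equivalence of blocks of H: their wreath stabilizers coincide.
_≈ʷ⟨_,_⟩_ : ∀ {n m} → Fin m → PermGroup n → (Fin m → Subset n) → Fin m → Set₁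
i ≈ʷ⟨ H , ℬ ⟩ j = WStab H ℬ i ≐ WStab H ℬ j

module _ {n m} {H : PermGroup n} {ℬ : Fin m → Subset n} where

  open IsStabilizing

  WStab-trivial : ∀ {i g} → WStab H ℬ i g → AgreeOn g id (ℬ i)
  WStab-trivial (gen (K , stab , g∈)) x∈ = trivial-on-i stab g∈ x∈
  WStab-trivial one x∈ = refl
  WStab-trivial (mul {h = h} p q) x∈ =
    trans (cong (h ⟨$⟩ʳ_) (WStab-trivial p x∈)) (WStab-trivial q x∈)
  WStab-trivial (inv {g} p) x∈ =
    trans (cong (g ⟨$⟩ˡ_) (sym (WStab-trivial p x∈))) (inverseˡ g)
  WStab-trivial (resp g≈h p) x∈ = trans (sym (g≈h _)) (WStab-trivial p x∈)

  -- The blocks on which a stabilizing subgroup is trivial form a union of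
  -- equivalence classes: the subgroup is stabilizing for each of them.
  trivial-≈ʷ : ∀ {K i j k} → IsStabilizing H ℬ i K → TrivialOn K (ℬ j) →
               j ≈ʷ⟨ H , ℬ ⟩ k → TrivialOn K (ℬ k)
  trivial-≈ʷ {K} stab triv (j⊆k , _) g∈ =
    WStab-trivial (j⊆k (gen (K , stab′ , g∈)))
    where
    stab′ : IsStabilizing H ℬ _ K
    stab′ = record { ≤-fix = ≤-fix stab ; trivial-on-i = triv
                   ; trivial-or-transitive = trivial-or-transitive stab }

Generated-bind : ∀ {n ℓ₁ ℓ₂} {P : Pred (Permutation′ n) ℓ₁} {Q : Pred (Permutation′ n) ℓ₂} →
                (∀ {g} → P g → Generated Q g) → ∀ {g} → Generated P g → Generated Q g
Generated-bind f (gen p)      = f p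
Generated-bind f one          = one
Generated-bind f (mul p q)    = mul (Generated-bind f p) (Generated-bind f q)
Generated-bind f (inv p)      = inv (Generated-bind f p)
Generated-bind f (resp eq p)  = resp eq (Generated-bind f p)

WStab-mono : ∀ {n m} {H₁ H₂ : PermGroup n} {ℬ₁ ℬ₂ : Fin m → Subset n} →
             H₁ ≤ᴳ H₂ → (∀ i → ℬ₁ i ≡ ℬ₂ i) →
             ∀ {i g} → WStab H₁ ℬ₁ i g → WStab H₂ ℬ₂ i g
WStab-mono {H₁ = H₁} {H₂} {ℬ₁} {ℬ₂} H₁≤H₂ eq {i} =
  Generated-bind λ (K , stab , g∈) → gen (K , mono stab , g∈)
  where
  open IsStabilizing
  mono : ∀ {K} → IsStabilizing H₁ ℬ₁ i K → IsStabilizing H₂ ℬ₂ i K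
  mono {K} stab = record
    { ≤-fix = λ {g} g∈ → let g∈H , fix = ≤-fix stab g∈ in
        H₁≤H₂ g∈H , λ j → subst (λ B → g ⟨ B ⟩ ≡ B) (eq j) (fix j)
    ; trivial-on-i = subst (TrivialOn K) (eq i) (trivial-on-i stab)
    ; trivial-or-transitive = λ j →
        subst (λ B → TrivialOn K B ⊎ TransitiveOn K B) (eq j) (trivial-or-transitive stab j)
    }

-- The index set I is a union of equivalence classes of blocks.
Saturated : ∀ {n m} → PermGroup n → (Fin m → Subset n) → Subset m → Set₁
Saturated H ℬ I = ∀ {i j} → i ≈ʷ⟨ H , ℬ ⟩ j → i ∈ I → j ∈ I

-- Every equivalence class of blocks is a finite subset of the index set.
Classes : ∀ {n m} → PermGroup n → (Fin m → Subset n) → Set₁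
Classes H ℬ = ∀ i → ∃[ I ] ∀ j → j ∈ I ⇔ (i ≈ʷ⟨ H , ℬ ⟩ j)

-- Finitely many instances of excluded middle hold together up to double
-- negation.
¬¬-Classes : ∀ {n m} (H : PermGroup n) (ℬ : Fin m → Subset n) → ¬ ¬ Classes H ℬ
¬¬-Classes H ℬ = ¬¬-map
  (λ dec i → ⟦ dec i ⟧ , λ j → mk⇔ (∈-⟦⟧⁻ (dec i)) (∈-⟦⟧⁺ (dec i)))
  (sequence app λ i → sequence app λ j → ¬¬-excluded-middle)
  where app = RawMonad.rawApplicative ¬¬-Monad

------------------------------------------------------------------------
-- Removing the action on a union of classes

module _ {n} (g : Permutation′ n) (E : Subset n) where

  moveOn-∈ : ∀ {x} → x ∈ E → moveOn g E x ≡ g ⟨$⟩ʳ x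
  moveOn-∈ {x} x∈ with lookup E x | []=⇒lookup x∈
  ... | true | _ = refl

  moveOn-∉ : ∀ {x} → x ∉ E → moveOn g E x ≡ x
  moveOn-∉ {x} x∉ with lookup E x in eq
  ... | true  = contradiction (lookup⇒[]= x E eq) x∉
  ... | false = refl

-- The permutation h is the identity on the blocks indexed by I and agrees
-- with g on the other blocks.
SuppressedOn : ∀ {n m} → (Fin m → Subset n) → Subset m → Permutation′ n → Permutation′ n → Set
SuppressedOn ℬ I g h =
  (∀ {i} → i ∈ I → AgreeOn h id (ℬ i)) × (∀ {i} → i ∉ I → AgreeOn h g (ℬ i))

module _ {n m} (ℬ : Fin m → Subset n) {I : Subset m} {g h : Permutation′ n}
         (suppressed : SuppressedOn ℬ I g h) where

  Induces-suppressed : ∀ σ → Induces ℬ g σ → (∀ {i} → i ∈ I → σ ⟨$⟩ʳ i ≡ i) →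
                       Induces ℬ h σ
  Induces-suppressed σ ind σ-fixed i with i ∈? I
  ... | yes i∈ = trans (image-cong h id (proj₁ suppressed i∈))
                       (trans (⟨⟩-id (ℬ i)) (cong ℬ (sym (σ-fixed i∈))))
  ... | no  i∉ = trans (image-cong h g (proj₂ suppressed i∉)) (ind i)

  -- Dividing g by h leaves the restriction of g to the union of the blocks
  -- indexed by I.
  quotient-on : ∀ {i} → i ∈ I → g ⟨ ℬ i ⟩ ≡ ℬ i → AgreeOn (g ∘ₚ flip h) g (ℬ i)
  quotient-on {i} i∈ fix {x} x∈ =
    trans (cong (h ⟨$⟩ˡ_) (sym (proj₁ suppressed i∈ gx∈))) (inverseˡ h)
    where
    gx∈ : g ⟨$⟩ʳ x ∈ ℬ i
    gx∈ = subst (_ ∈_) fix (∈⇒image g (ℬ i) x∈)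

  quotient-off : ∀ {i} → i ∉ I → AgreeOn (g ∘ₚ flip h) id (ℬ i)
  quotient-off i∉ x∈ =
    trans (cong (h ⟨$⟩ˡ_) (sym (proj₂ suppressed i∉ x∈))) (inverseˡ h)

module _ {n m} {G H : PermGroup n} {ℬ : Fin m → Subset n}
         (G-closed : FiveHalvesClosed G) (H≤G : H ≤ᴳ G) (H-trans : Transitive H)
         (nbs : IsNormalBlockSystem H ℬ) (classes : Classes H ℬ) where

  open NormalBlockSystem H H-trans ℬ nbs

  -- In a 5/2-closed group the action on one fixer block after the other can
  -- be divided out, hence so can the action on any union of fixer blocks.
  suppress : ∀ {I} → Saturated H ℬ I → ∀ {g} → g ∈ᴳ G →
             (∀ {i} → i ∈ I → g ⟨ ℬ i ⟩ ≡ ℬ i) →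
             ∃[ h ] h ∈ᴳ G × SuppressedOn ℬ I g h
  suppress {I} sat {g} g∈ fixes =
    let h , h∈ , _ , off , on = partial (allFin m)
    in h , h∈ , (λ {i} → on (∈-allFin i)) , off
    where
    -- The classes of the members of l lying in I have been dealt with.  The
    -- third component ensures that the current h still fixes the blocks
    -- indexed by I, so that closure applies to it.
    partial : (l : List (Fin m)) →
      ∃[ h ] h ∈ᴳ G × (∀ i → AgreeOn h id (ℬ i) ⊎ AgreeOn h g (ℬ i))
                    × (∀ {i} → i ∉ I → AgreeOn h g (ℬ i))
                    × (∀ {t} → t ∈ˡ l → t ∈ I → AgreeOn h id (ℬ t))
    partial []      = g , g∈ , (λ _ → inj₂ λ _ → refl) , (λ _ _ → refl) , λ ()
    partial (t ∷ l) with partial l | t ∈? I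
    ... | h , h∈ , either , off , on | no t∉ = h , h∈ , either , off , λ where
          (here refl) t∈  → contradiction t∈ t∉
          (there s∈)  s∈I → on s∈ s∈I
    ... | h , h∈ , either , off , on | yes t∈ = h′ , h′∈ , either′ , off′ , λ where
          (here refl) _   → on-class (from (class t) ≐-refl)
          (there s∈)  s∈I → on′ s∈ s∈I
      where
      J     = proj₁ (classes t)
      class = proj₂ (classes t)
      E     = ⋃[ ℬ ] J

      E∈ : FixerSystem H ℬ E
      E∈ = J , (t , class) , refl

      h-fixes : ∀ i → ℬ i ⊆ E → h ⟨ ℬ i ⟩ ≡ ℬ i
      h-fixes i ⊆E with either i
      ... | inj₁ h≡id = trans (image-cong h id h≡id) (⟨⟩-id (ℬ i))
      ... | inj₂ h≡g  = trans (image-cong h g h≡g)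
                              (fixes (sat (to (class i) (⊆⋃⇒∈ ⊆E)) t∈))

      r = restrict h E (fixer-stable {G = H} E∈ h h-fixes)

      -- Composing with the inverse of the restriction of h to E leaves h
      -- unchanged off E and makes it trivial on E.
      h′ = flip r ∘ₚ h

      h′∈ : h′ ∈ᴳ G
      h′∈ = ∘-∈ G {flip r} {h} (flip-∈ G {r} r∈) h∈
        where
        r∈ : r ∈ᴳ G
        r∈ = FiveHalvesClosed.closed G-closed H H≤G H-trans ℬ nbs E∈ h h∈ h-fixes

      on-class : ∀ {i} → i ∈ J → AgreeOn h′ id (ℬ i)
      on-class i∈ x∈ =
        trans (cong (h ⟨$⟩ʳ_) (moveOn-∈ (flip h) E (∈⋃⁺ ℬ i∈ x∈))) (inverseʳ h)

      off-class : ∀ {i} → i ∉ J → AgreeOn h′ h (ℬ i)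
      off-class i∉ x∈ = cong (h ⟨$⟩ʳ_) (moveOn-∉ (flip h) E λ x∈E → i∉ (⋃-∈ x∈ x∈E))

      either′ : ∀ i → AgreeOn h′ id (ℬ i) ⊎ AgreeOn h′ g (ℬ i)
      either′ i with i ∈? J
      ... | yes i∈ = inj₁ (on-class i∈)
      ... | no  i∉ = Sum.map (λ eq x∈ → trans (off-class i∉ x∈) (eq x∈))
                             (λ eq x∈ → trans (off-class i∉ x∈) (eq x∈)) (either i)

      off′ : ∀ {i} → i ∉ I → AgreeOn h′ g (ℬ i)
      off′ i∉ x∈ = trans (off-class (λ i∈ → i∉ (sat (to (class _) i∈) t∈)) x∈) (off i∉ x∈)

      on′ : ∀ {s} → s ∈ˡ l → s ∈ I → AgreeOn h′ id (ℬ s)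
      on′ {s} s∈ s∈I with s ∈? J
      ... | yes s∈J = on-class s∈J
      ... | no  s∉J = λ x∈ → trans (off-class s∉J x∈) (on s∈ s∈I x∈)

------------------------------------------------------------------------
-- Lifting a block system of a subgroup of the quotient

module Lift {n m k} {G : PermGroup n} (G-trans : Transitive G)
            {ℬ : Fin m → Subset n} (ℬ-nbs : IsNormalBlockSystem G ℬ)
            {H′ : PermGroup m} (H′≤ : H′ ≤ᴳ G / ℬ) (H′-trans : Transitive H′)
            {𝒟 : Fin k → Subset m} (𝒟-nbs : IsNormalBlockSystem H′ 𝒟) where

  private
    module B = NormalBlockSystem G G-trans ℬ ℬ-nbs
    module D = NormalBlockSystem H′ H′-trans 𝒟 𝒟-nbs

  H : PermGroup n
  H = lift G ℬ H′

  -- The block system induced by 𝒟.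
  𝒞 : Fin k → Subset n
  𝒞 c = ⋃[ ℬ ] (𝒟 c)

  H≤G : H ≤ᴳ G
  H≤G = proj₁

  H-trans : Transitive H
  H-trans x y =
    let i , x∈ = B.covers x
        j , y∈ = B.covers y
        σ , σ∈ , σi≡j = H′-trans i j
        g , g∈ , ind , gx≡y =
          B.lift-point σ (H′≤ σ∈) x∈ (subst (λ z → y ∈ ℬ z) (sym σi≡j) y∈)
    in g , (g∈ , σ , σ∈ , ind) , gx≡y

  -- The normal subgroup of H with orbits 𝒞: the preimage of one with orbits 𝒟.
  M : PermGroup n
  M = lift G ℬ D.N

  M⊴H : M ⊴ H
  M⊴H = (λ (g∈ , σ , σ∈ , ind) → g∈ , σ , proj₁ D.N⊴H σ∈ , ind) ,
    λ { {g} {h} (g∈ , σ , σ∈ , p) (h∈ , τ , τ∈ , q) →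
      ∘-∈ G (flip-∈ G g∈) (∘-∈ G h∈ g∈) ,
      flip σ ∘ₚ τ ∘ₚ σ , proj₂ D.N⊴H σ∈ τ∈ ,
      Induces-∘ ℬ (flip g) (h ∘ₚ g) (flip σ) (τ ∘ₚ σ)
        (Induces-flip ℬ g σ p) (Induces-∘ ℬ h g τ σ q p) }

  𝒞-orbit : ∀ {c i x} → i ∈ 𝒟 c → x ∈ ℬ i →
            ∀ y → y ∈ 𝒞 c ⇔ (∃[ g ] g ∈ᴳ M × g ⟨$⟩ʳ x ≡ y)
  𝒞-orbit {c} {i} {x} i∈ x∈ y = mk⇔
    (λ y∈ →
      let j , j∈ , y∈j = ∈⋃⁻ ℬ y∈
          σ , σ∈ , σi≡j = to (D.orbit i∈ j) j∈
          g , g∈ , ind , gx≡y = B.lift-point σ (H′≤ (proj₁ D.N⊴H σ∈)) x∈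
                                  (subst (λ z → y ∈ ℬ z) (sym σi≡j) y∈j)
      in g , (g∈ , σ , σ∈ , ind) , gx≡y)
    (λ (g , (g∈ , σ , σ∈ , ind) , gx≡y) →
      ∈⋃⁺ ℬ (from (D.orbit i∈ (σ ⟨$⟩ʳ i)) (σ , σ∈ , refl))
            (subst (_∈ ℬ (σ ⟨$⟩ʳ i)) gx≡y (Induces-∈ ℬ g σ ind x∈)))

  𝒞-normal : IsNormalBlockSystem H 𝒞
  𝒞-normal =
    (⋃[ ℬ ] D₀ , nonempty , isBlock , injective , ⊆translates , translates⊆) ,
    M , M⊴H , injective , ⊆orbits , orbits⊆
    where
    D₀ = proj₁ (proj₁ 𝒟-nbs)

    block : IsBlock H′ D₀
    block = proj₁ (proj₂ (proj₂ (proj₁ 𝒟-nbs)))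

    members : Members 𝒟 ≐ Translates H′ D₀
    members = proj₂ (proj₂ (proj₂ (proj₂ (proj₁ 𝒟-nbs))))

    nonempty : Nonempty (⋃[ ℬ ] D₀)
    nonempty = let i , i∈ = proj₁ (proj₂ (proj₁ 𝒟-nbs))
                   x , x∈ = B.nonempty i
               in x , ∈⋃⁺ ℬ i∈ x∈

    isBlock : IsBlock H (⋃[ ℬ ] D₀)
    isBlock {g} (g∈ , σ , σ∈ , ind) = Sum.map
      (λ eq → trans image-∩ (trans (cong ⋃[ ℬ ] eq) B.⋃-⊥))
      (λ eq → trans image-∩ (cong ⋃[ ℬ ] eq))
      (block σ∈)
      where
      image-∩ : g ⟨ ⋃[ ℬ ] D₀ ⟩ ∩ ⋃[ ℬ ] D₀ ≡ ⋃[ ℬ ] (σ ⟨ D₀ ⟩ ∩ D₀)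
      image-∩ = trans (cong (_∩ ⋃[ ℬ ] D₀) (image-⋃ ℬ g σ ind D₀))
                      (B.⋃-∩ (σ ⟨ D₀ ⟩) D₀)

    injective : ∀ {c d} → 𝒞 c ≡ 𝒞 d → c ≡ d
    injective eq = D.injective (B.⋃-injective eq)

    ⊆translates : ∀ {C} → Members 𝒞 C → Translates H (⋃[ ℬ ] D₀) C
    ⊆translates (c , refl) =
      let σ , σ∈ , eq = proj₁ members (c , refl)
          g , g∈ , ind = H′≤ σ∈
      in g , (g∈ , σ , σ∈ , ind) , trans (image-⋃ ℬ g σ ind D₀) (cong ⋃[ ℬ ] eq)

    translates⊆ : ∀ {C} → Translates H (⋃[ ℬ ] D₀) C → Members 𝒞 C
    translates⊆ (g , (g∈ , σ , σ∈ , ind) , eq) =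
      let c , eq′ = proj₂ members (σ , σ∈ , refl)
      in c , trans (cong ⋃[ ℬ ] eq′) (trans (sym (image-⋃ ℬ g σ ind D₀)) eq)

    ⊆orbits : ∀ {C} → Members 𝒞 C → Orbits M C
    ⊆orbits (c , refl) =
      let i , i∈ = D.nonempty c
          x , x∈ = B.nonempty i
      in x , 𝒞-orbit i∈ x∈

    orbits⊆ : ∀ {C} → Orbits M C → Members 𝒞 C
    orbits⊆ (x , orb) =
      let i , x∈ = B.covers x
          c , i∈ = D.covers i
      in c , ⊆-antisym
           (λ {y} y∈ → from (orb y) (to (𝒞-orbit i∈ x∈ y) y∈))
           (λ {y} y∈ → from (𝒞-orbit i∈ x∈ y) (to (orb y) y∈))

  ℬ⪯𝒞 : Members ℬ ⪯ Members 𝒞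
  ℬ⪯𝒞 (i , refl) = let c , i∈ = D.covers i in 𝒞 c , (c , refl) , λ x∈ → ∈⋃⁺ ℬ i∈ x∈

  H/ℬ≤H′ : H / ℬ ≤ᴳ H′
  H/ℬ≤H′ {σ} (g , (_ , τ , τ∈ , p) , q) = ∈-resp-≈ H′ {τ} {σ} (B.Induces-unique g τ σ p q) τ∈

  H′≤H/ℬ : H′ ≤ᴳ H / ℬ
  H′≤H/ℬ {σ} σ∈ = let g , g∈ , ind = H′≤ σ∈ in g , (g∈ , σ , σ∈ , ind) , ind

  𝒞/ℬ≡𝒟 : ∀ c → (𝒞 /ᵇ ℬ) c ≡ 𝒟 c
  𝒞/ℬ≡𝒟 c = ⊆-antisym
    (λ i∈ → B.⊆⋃⇒∈ (∈-⟦⟧⁻ (λ i → ℬ i ⊆? 𝒞 c) i∈))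
    (λ i∈ → ∈-⟦⟧⁺ (λ i → ℬ i ⊆? 𝒞 c) (λ x∈ → ∈⋃⁺ ℬ i∈ x∈))

  -- If the induced fixer block system of the quotient coarsens the ℬ-fixer
  -- block system of G, then equivalent blocks of ℬ lie in equivalent blocks of 𝒟.
  coarser : Classes G ℬ → FixerSystem G ℬ ⪯ Induced ℬ (FixerSystem (H / ℬ) (𝒞 /ᵇ ℬ)) →
            ∀ {i j c d} → i ≈ʷ⟨ G , ℬ ⟩ j → i ∈ 𝒟 c → j ∈ 𝒟 d → c ≈ʷ⟨ H′ , 𝒟 ⟩ d
  coarser classes hyp {i} {j} {c} {d} i~j i∈ j∈
    with I , class ← classes i
    with _ , (_ , (J , (c₀ , class₀) , refl) , refl) , sub ← hyp (I , (i , class) , refl)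
    = c⊆d , d⊆c
    where
    -- J indexes the fixer block of H/ℬ whose union contains that of I.
    index : ∀ {a e} → a ∈ I → a ∈ 𝒟 e → e ∈ J
    index {a} {e} a∈ a∈e =
      let f , f∈ , a∈f = ∈⋃⁻ (𝒞 /ᵇ ℬ) (B.⊆⋃⇒∈ λ x∈ → sub (∈⋃⁺ ℬ a∈ x∈))
      in subst (_∈ J) (D.disjoint (subst (a ∈_) (𝒞/ℬ≡𝒟 f) a∈f) a∈e) f∈

    c₀~c : WStab (H / ℬ) (𝒞 /ᵇ ℬ) c₀ ≐ WStab (H / ℬ) (𝒞 /ᵇ ℬ) c
    c₀~c = to (class₀ c) (index (from (class i) ≐-refl) i∈)

    c₀~d : WStab (H / ℬ) (𝒞 /ᵇ ℬ) c₀ ≐ WStab (H / ℬ) (𝒞 /ᵇ ℬ) d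
    c₀~d = to (class₀ d) (index (from (class j) i~j) j∈)

    up : ∀ {e g} → WStab H′ 𝒟 e g → WStab (H / ℬ) (𝒞 /ᵇ ℬ) e g
    up = WStab-mono {H₁ = H′} {H / ℬ} (λ {g} → H′≤H/ℬ {g}) (λ e → sym (𝒞/ℬ≡𝒟 e))

    down : ∀ {e g} → WStab (H / ℬ) (𝒞 /ᵇ ℬ) e g → WStab H′ 𝒟 e g
    down = WStab-mono {H₁ = H / ℬ} {H′} (λ {g} → H/ℬ≤H′ {g}) 𝒞/ℬ≡𝒟

    c⊆d : ∀ {g} → WStab H′ 𝒟 c g → WStab H′ 𝒟 d g
    c⊆d w = down (proj₁ c₀~d (proj₂ c₀~c (up w)))

    d⊆c : ∀ {g} → WStab H′ 𝒟 d g → WStab H′ 𝒟 c g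
    d⊆c w = down (proj₁ c₀~c (proj₂ c₀~d (up w)))

  -- Lifting a subgroup K as in the definition of the wreath stabilizer of 𝒟 c to
  -- one as in the definition of the wreath stabilizer of 𝒞 c.
  module Descent (G-closed : FiveHalvesClosed G) (classes : Classes G ℬ)
                 (hyp : FixerSystem G ℬ ⪯ Induced ℬ (FixerSystem (H / ℬ) (𝒞 /ᵇ ℬ)))
                 {c} {K : PermGroup m} (K-stab : IsStabilizing H′ 𝒟 c K) where

    open IsStabilizing

    -- T indexes the blocks of ℬ in the blocks of 𝒟 on which K is trivial.
    trivial? : ∀ i → Dec (∃[ d ] i ∈ 𝒟 d × TrivialOn K (𝒟 d))
    trivial? i = any? λ d → (i ∈? 𝒟 d) ×-dec trivialOn? K (𝒟 d)

    T : Subset m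
    T = ⟦ trivial? ⟧

    T⁺ : ∀ {d i} → TrivialOn K (𝒟 d) → i ∈ 𝒟 d → i ∈ T
    T⁺ {d} triv i∈ = ∈-⟦⟧⁺ trivial? (d , i∈ , triv)

    T⁻ : ∀ {d i} → i ∈ T → i ∈ 𝒟 d → TrivialOn K (𝒟 d)
    T⁻ i∈T i∈ with e , i∈e , triv ← ∈-⟦⟧⁻ trivial? i∈T
              with refl ← D.disjoint i∈e i∈ = triv

    -- The blocks of 𝒟 on which K is trivial form a union of classes, and
    -- equivalent blocks of ℬ lie in equivalent blocks of 𝒟.
    T-saturated : Saturated G ℬ T
    T-saturated {i} {j} i~j i∈T =
      let d , i∈ = D.covers i
          e , j∈ = D.covers j
      in T⁺ (trivial-≈ʷ K-stab (T⁻ i∈T i∈) (coarser classes hyp i~j i∈ j∈)) j∈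

    -- The elements of G which induce an element of K and fix every point of
    -- the blocks indexed by T.
    L : PermGroup n
    L = fixing (lift G ℬ K) (⋃[ ℬ ] T)

    -- Any lift of an element of K can be changed into one in L, without
    -- affecting its action on the blocks not indexed by T.
    adjust : ∀ {g σ} → g ∈ᴳ G → σ ∈ᴳ K → Induces ℬ g σ →
             ∃[ h ] h ∈ᴳ L × Induces ℬ h σ × (∀ {i} → i ∉ T → AgreeOn h g (ℬ i))
    adjust {g} {σ} g∈ σ∈ ind =
      let h , h∈ , suppressed = suppress G-closed (λ g∈G → g∈G) G-trans ℬ-nbs classes
                                  T-saturated g∈ λ i∈T → trans (ind _) (cong ℬ (σ-fixed i∈T))
          h-ind = Induces-suppressed ℬ {g = g} {h} suppressed σ ind σ-fixed
      in h , ((h∈ , σ , σ∈ , h-ind) , fixed {h} suppressed) , h-ind , proj₂ suppressed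
      where
      σ-fixed : ∀ {i} → i ∈ T → σ ⟨$⟩ʳ i ≡ i
      σ-fixed i∈T = let d , i∈ = D.covers _ in T⁻ i∈T i∈ σ∈ i∈

      fixed : ∀ {h} → SuppressedOn ℬ T g h → ∀ x → x ∈ ⋃[ ℬ ] T → h ⟨$⟩ʳ x ≡ x
      fixed (on , _) x x∈ = let i , i∈T , x∈i = ∈⋃⁻ ℬ x∈ in on i∈T x∈i

    L-stab : IsStabilizing H 𝒞 c L
    L-stab = record
      { ≤-fix = λ { {g} ((g∈ , σ , σ∈ , ind) , _) →
          let σ∈H′ , σ-fix = ≤-fix K-stab σ∈ in
          (g∈ , σ , σ∈H′ , ind) ,
          λ d → trans (image-⋃ ℬ g σ ind (𝒟 d)) (cong ⋃[ ℬ ] (σ-fix d)) }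
      ; trivial-on-i = trivial (trivial-on-i K-stab)
      ; trivial-or-transitive = trivial-or-trans
      }
      where
      trivial : ∀ {d} → TrivialOn K (𝒟 d) → TrivialOn L (𝒞 d)
      trivial triv (_ , fixed) {x} x∈ =
        let i , i∈ , x∈i = ∈⋃⁻ ℬ x∈ in fixed x (∈⋃⁺ ℬ (T⁺ triv i∈) x∈i)

      transitive : ∀ {d} → ¬ TrivialOn K (𝒟 d) → TransitiveOn K (𝒟 d) → TransitiveOn L (𝒞 d)
      transitive ¬triv trans-K {x} {y} x∈ y∈ =
        let i , i∈ , x∈i = ∈⋃⁻ ℬ x∈
            j , j∈ , y∈j = ∈⋃⁻ ℬ y∈
            σ , σ∈ , σi≡j = trans-K i∈ j∈
            g , g∈ , ind , gx≡y = B.lift-point σ (H′≤ (proj₁ (≤-fix K-stab σ∈))) x∈i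
                                    (subst (λ z → y ∈ ℬ z) (sym σi≡j) y∈j)
            h , h∈ , _ , off = adjust g∈ σ∈ ind
        in h , h∈ , trans (off (λ i∈T → ¬triv (T⁻ i∈T i∈)) x∈i) gx≡y

      trivial-or-trans : ∀ d → TrivialOn L (𝒞 d) ⊎ TransitiveOn L (𝒞 d)
      trivial-or-trans d with trivialOn? K (𝒟 d) | trivial-or-transitive K-stab d
      ... | yes triv | _            = inj₁ (trivial triv)
      ... | no ¬triv | inj₁ triv    = contradiction (λ {g} → triv {g}) ¬triv
      ... | no ¬triv | inj₂ trans-K = inj₂ (transitive ¬triv trans-K)

    -- Elements of K lift to L, so triviality of L on 𝒞 d descends to K.
    descend : ∀ {d} → (∀ {g} → WStab H 𝒞 c g → WStab H 𝒞 d g) → TrivialOn K (𝒟 d)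
    descend {d} c⊆d {σ} σ∈ {i} i∈ =
      let g , g∈ , ind = H′≤ (proj₁ (≤-fix K-stab σ∈))
          h , h∈ , h-ind , _ = adjust g∈ σ∈ ind
          x , x∈ = B.nonempty i
      in B.Induces-fixed h σ h-ind x∈
           (WStab-trivial (c⊆d (gen (L , L-stab , h∈))) (∈⋃⁺ ℬ i∈ x∈))

  -- Equivalent blocks of 𝒞 lie over equivalent blocks of 𝒟.
  ≈ʷ-descends : FiveHalvesClosed G → Classes G ℬ →
                FixerSystem G ℬ ⪯ Induced ℬ (FixerSystem (H / ℬ) (𝒞 /ᵇ ℬ)) →
                ∀ {c d} → c ≈ʷ⟨ H , 𝒞 ⟩ d → c ≈ʷ⟨ H′ , 𝒟 ⟩ d
  ≈ʷ-descends G-closed classes hyp (c⊆d , d⊆c) =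
    Generated-bind (half c⊆d) , Generated-bind (half d⊆c)
    where
    open IsStabilizing
    -- A group which is stabilizing for 𝒟 c and trivial on 𝒟 d is stabilizing
    -- for 𝒟 d.
    half : ∀ {c d} → (∀ {g} → WStab H 𝒞 c g → WStab H 𝒞 d g) →
           ∀ {σ} → ∃[ K ] (IsStabilizing H′ 𝒟 c K × σ ∈ᴳ K) → WStab H′ 𝒟 d σ
    half sub (K , stab , σ∈) = gen (K , record
      { ≤-fix = ≤-fix stab
      ; trivial-on-i = Descent.descend G-closed classes hyp stab sub
      ; trivial-or-transitive = trivial-or-transitive stab } , σ∈)

  -- A lift of σ, restricted to the union of the blocks of ℬ indexed by E, lies
  -- in G and induces the restriction of σ to E.
  restrict-lifts : FiveHalvesClosed G → Classes G ℬ → Classes H 𝒞 →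
    FixerSystem G ℬ ⪯ Induced ℬ (FixerSystem (H / ℬ) (𝒞 /ᵇ ℬ)) →
    ∀ {E} (E∈ : FixerSystem H′ 𝒟 E) σ → σ ∈ᴳ G / ℬ →
    (fixes : ∀ c → 𝒟 c ⊆ E → σ ⟨ 𝒟 c ⟩ ≡ 𝒟 c) →
    restrict σ E (fixer-stable {G = H′} E∈ σ fixes) ∈ᴳ G / ℬ
  restrict-lifts G-closed ℬ-classes 𝒞-classes hyp {E}
                 E∈@(I , (c₀ , class) , refl) σ (g , g∈ , ind) fixes =
    let h , h∈ , suppressed = suppress G-closed H≤G H-trans 𝒞-normal 𝒞-classes
                                I-saturated g∈ g-fixes
    in g ∘ₚ flip h , ∘-∈ G g∈ (flip-∈ G h∈) , induces {h} suppressed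
    where
    I-saturated : Saturated H 𝒞 I
    I-saturated {c} {d} c~d c∈ =
      from (class d) (≐-trans (to (class c) c∈) (≈ʷ-descends G-closed ℬ-classes hyp c~d))

    g-fixes : ∀ {c} → c ∈ I → g ⟨ 𝒞 c ⟩ ≡ 𝒞 c
    g-fixes {c} c∈ = trans (image-⋃ ℬ g σ ind (𝒟 c))
                           (cong ⋃[ ℬ ] (fixes c λ i∈ → ∈⋃⁺ 𝒟 c∈ i∈))

    induces : ∀ {h} → SuppressedOn 𝒞 I g h →
              Induces ℬ (g ∘ₚ flip h) (restrict σ E (fixer-stable {G = H′} E∈ σ fixes))
    induces {h} suppressed i with c , i∈ ← D.covers i with c ∈? I
    ... | yes c∈ =
      trans (image-cong (g ∘ₚ flip h) g λ x∈ →
              quotient-on 𝒞 {g = g} {h} suppressed c∈ (g-fixes c∈) (∈⋃⁺ ℬ i∈ x∈))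
        (trans (ind i) (cong ℬ (sym (moveOn-∈ σ E (∈⋃⁺ 𝒟 c∈ i∈)))))
    ... | no c∉ =
      trans (image-cong (g ∘ₚ flip h) id λ x∈ →
              quotient-off 𝒞 {g = g} {h} suppressed c∉ (∈⋃⁺ ℬ i∈ x∈))
        (trans (⟨⟩-id (ℬ i))
          (cong ℬ (sym (moveOn-∉ σ E λ i∈E → c∉ (D.⋃-∈ i∈ i∈E)))))

theorem2p3 : ∀ {n m} (G : PermGroup n) (ℬ : Fin m → Subset n) →
    FiveHalvesClosed G →
    IsNormalBlockSystem G ℬ →
    (∀ (H : PermGroup n) → H ≤ᴳ G → Transitive H →
    ∀ {k} (𝒞 : Fin k → Subset n) → IsNormalBlockSystem H 𝒞 →
    Members ℬ ⪯ Members 𝒞 →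
    FixerSystem G ℬ ⪯ Induced ℬ (FixerSystem (H / ℬ) (𝒞 /ᵇ ℬ))) →
    FiveHalvesClosed (G / ℬ)
theorem2p3 G ℬ G-closed ℬ-nbs hyp = record
  { transitive = NormalBlockSystem.quotient-transitive G G-trans ℬ ℬ-nbs
  ; closed = λ H′ H′≤ H′-trans 𝒟 𝒟-nbs E∈ σ σ∈ fixes →
      let open Lift G-trans ℬ-nbs {H′ = H′} H′≤ H′-trans 𝒟-nbs in
      decidable-stable
        (_∈ᴳ?_ (G / ℬ) (restrict σ _ (fixer-stable {G = H′} E∈ σ fixes))) λ ∉G/ℬ →
        ¬¬-Classes G ℬ λ ℬ-classes →
        ¬¬-Classes H 𝒞 λ 𝒞-classes →
        ∉G/ℬ (restrict-lifts G-closed ℬ-classes 𝒞-classes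
               (hyp H H≤G H-trans 𝒞 𝒞-normal ℬ⪯𝒞) E∈ σ σ∈ fixes)
  }
  where G-trans = FiveHalvesClosed.transitive G-closed
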